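{- Let $\mathbf E=(E,\#,\gg)$ be a context-dependent event structure. Then there exists an elementary context-dependent event structure $\mathbf E'=(E,\#',\gg')$ on the same set of events such that $\mathrm{Conf}(\mathbf E)=\mathrm{Conf}(\mathbf E')$.
   Context: A context-dependent event structure (CDES) is a triple $\mathbf E=(E,\#,\gg)$ where $E$ is a set of events, $\#\subseteq E\times E$ is an irreflexive symmetric conflict relation, and $\gg\subseteq \mathcal P(\mathbf A)\times E$ with $\mathbf A\subseteq\mathcal P_{\mathrm{fin}}(E)\times\mathcal P_{\mathrm{fin}}(E)$ (the context-dependency relation), such that whenever $\mathbf Z\gg e$: $\mathbf Z$ is nonempty and finite; for each $(X,Y)\in\mathbf Z$ both $X$ and $Y$ are conflict-free (no two distinct elements in $\#$); and if $(X,Y),(X,Y')\in\mathbf Z$ then $Y=Y'$. For $\mathbf Z=\{(X_1,Y_1),\dots,(X_n,Y_n)\}$ let $\mathrm{Cxt}(\mathbf Z)=\bigcup_i X_i$. An event $e\notin C$ is enabled at $C\subseteq E$ if for every $\mathbf Z\gg e$ there is $(X_i,Y_i)\in\mathbf Z$ with $\mathrm{Cxt}(\mathbf Z)\cap C=X_i$ and $Y_i\subseteq C$. A set $C\subseteq E$ is a configuration if there is a sequence of distinct events $e_1e_2\cdots$ whose set of elements is $C$, $C$ is conflict-free, and each $e_i$ is enabled at $\{e_1,\dots,e_{i-1}\}$. $\mathrm{Conf}(\mathbf E)$ is the set of configurations. A CDES is elementary if for every event $e$ there is exactly one $\mathbf Z$ with $\mathbf Z\gg e$.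
   Formalization: Proved under the added hypothesis that for each event e the union of Cxt(Z) over all Z ≫ e is finite; without it the statement fails, e.g. when infinitely many Z ≫ e have distinct contexts {a_i}, since an elementary structure has only one finite context per event. -}

module Defs where

open import Data.Nat using (ℕ; _<_)
open import Data.Fin using (Fin; toℕ)
open import Data.List using (List; []; concat; map)
open import Data.List.Membership.Propositional using (_∈_)
import Data.List.Relation.Binary.Subset.Propositional as List
open import Data.Product using (Σ; ∃; ∃!; _×_; _,_; proj₁)
open import Function using (_∘_)
open import Level using (Level; suc)
open import Relation.Binary using (Rel; Symmetric; Irreflexive)
open import Relation.Binary.PropositionalEquality using (_≡_; _≢_)
open import Relation.Nullary using (¬_)
open import Relation.Unary using (Pred; _∩_; _⊆_; _≐_)
  renaming (_∈_ to _∈ₚ_; _∉_ to _∉ₚ_)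

private variable
  ℓ : Level

-- Finite sets are represented by lists, which are only ever compared as sets:
-- order and multiplicity are ignored by _≋_, and by _≈ᶻ_ at both levels.

FinSet : Set ℓ → Set ℓ
FinSet E = List E

⟦_⟧ : {E : Set ℓ} → FinSet E → Pred E ℓ
⟦ X ⟧ x = x ∈ X

infix 4 _≋_ _⊑ᶻ_ _≈ᶻ_

_≋_ : {E : Set ℓ} → Rel (FinSet E) ℓ
X ≋ Y = X List.⊆ Y × Y List.⊆ X

-- Finite sets 𝐙 of pairs (X , Y).
Entries : Set ℓ → Set ℓ
Entries E = List (FinSet E × FinSet E)

_⊑ᶻ_ : {E : Set ℓ} → Rel (Entries E) ℓ
Z ⊑ᶻ Z′ = ∀ {X Y} → (X , Y) ∈ Z →
  ∃ λ X′ → ∃ λ Y′ → (X′ , Y′) ∈ Z′ × X ≋ X′ × Y ≋ Y′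

_≈ᶻ_ : {E : Set ℓ} → Rel (Entries E) ℓ
Z ≈ᶻ Z′ = Z ⊑ᶻ Z′ × Z′ ⊑ᶻ Z

Cxt : {E : Set ℓ} → Entries E → FinSet E
Cxt Z = concat (map proj₁ Z)

ConflictFree : {E : Set ℓ} → Rel E ℓ → Pred (Pred E ℓ) ℓ
ConflictFree _#_ C = ∀ {x y} → x ∈ₚ C → y ∈ₚ C → x ≢ y → ¬ (x # y)

-- _≫_ need not be closed under _≈ᶻ_: two lists with the same entries denote
-- the same 𝐙, and every notion below depends on the denoted set only.
record CDES (E : Set ℓ) : Set (suc ℓ) where
  infix 4 _#_ _≫_
  field
    _#_ : Rel E ℓ
    _≫_ : Entries E → E → Set ℓ
    #-irrefl : Irreflexive _≡_ _#_
    #-sym : Symmetric _#_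
    ≫-nonempty : ∀ {Z e} → Z ≫ e → Z ≢ []
    ≫-conflictFree : ∀ {Z e X Y} → Z ≫ e → (X , Y) ∈ Z →
      ConflictFree _#_ ⟦ X ⟧ × ConflictFree _#_ ⟦ Y ⟧
    ≫-functional : ∀ {Z e X Y X′ Y′} → Z ≫ e → (X , Y) ∈ Z → (X′ , Y′) ∈ Z →
      X ≋ X′ → Y ≋ Y′

Enabled : {E : Set ℓ} → CDES E → Pred E ℓ → E → Set ℓ
Enabled 𝐄 C e = e ∉ₚ C × (∀ {Z} → Z ≫ e →
  ∃ λ X → ∃ λ Y → (X , Y) ∈ Z × ⟦ Cxt Z ⟧ ∩ C ≐ ⟦ X ⟧ × ⟦ Y ⟧ ⊆ C)
  where open CDES 𝐄

-- Sequences of events may be finite or infinite.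
data Length : Set where
  finite : ℕ → Length
  ω      : Length

Position : Length → Set
Position (finite n) = Fin n
Position ω          = ℕ

index : ∀ l → Position l → ℕ
index (finite n) i = toℕ i
index ω          i = i

-- Before l s i is {e₁,…,eᵢ₋₁}, the set of events listed before position i.
Before : {E : Set ℓ} (l : Length) → (Position l → E) → Position l → Pred E ℓ
Before l s i e = ∃ λ j → index l j < index l i × s j ≡ e

record IsConfiguration {E : Set ℓ} (𝐄 : CDES E) (C : Pred E ℓ) : Set ℓ where
  open CDES 𝐄
  field
    len          : Length
    seq          : Position len → E
    distinct     : ∀ {i j} → seq i ≡ seq j → i ≡ j
    elements     : (λ e → ∃ λ i → seq i ≡ e) ≐ C
    conflictFree : ConflictFree _#_ C
    enabled      : ∀ i → Enabled 𝐄 (Before len seq i) (seq i)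

Conf : {E : Set ℓ} → CDES E → Pred (Pred E ℓ) ℓ
Conf = IsConfiguration

Elementary : {E : Set ℓ} → CDES E → Set ℓ
Elementary 𝐄 = ∀ e → ∃! _≈ᶻ_ (λ Z → Z ≫ e)
  where open CDES 𝐄

-- For each e, the union of Cxt(𝐙) over all 𝐙 ≫ e is finite; this holds when E
-- is finite, and when each e has finitely many 𝐙 ≫ e.  An event of an
-- elementary structure depends on one finite context, so some such bound is
-- needed to reach it.  Take events e, aᵢ, bᵢ (i ∈ ℕ) without conflicts,
-- {(∅,∅),({aᵢ},{bᵢ})} ≫ e for every i, {(∅,∅),({e},{aᵢ})} ≫ aᵢ, and
-- {(∅,∅)} ≫ bᵢ.  Then {e}, {aᵢ} and {aᵢ,bᵢ,e} are configurations and {aᵢ,e}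
-- is not, so in an elementary structure with the same configurations the
-- context of the only 𝐙 ≫ e would contain every aᵢ.
FinitaryContexts : {E : Set ℓ} → CDES E → Set ℓ
FinitaryContexts {E = E} 𝐄 =
  ∀ e → Σ (FinSet E) λ U → ∀ {Z} → Z ≫ e → Cxt Z List.⊆ U
  where open CDES 𝐄

{-# OPTIONS --safe #-}

-- Keep the conflict relation.  If C ∩ U is known, where U contains every Cxt(𝐙)
-- with 𝐙 ≫ e, then the entry selected in each 𝐙 is known, and e is enabled at C
-- exactly when every 𝐙 has such an entry and the union of the selected Y's lies
-- in C.  The single set of entries for e therefore pairs every conflict-free
-- X ⊆ U with that union.  Where some 𝐙 has no entry for X, or the union is
-- infinite or has a conflict, e can never be added, and X is paired with {e},
-- which blocks e.  Singletons being conflict-free, the new context is all of U.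
module Submission where

open import Level using (Level)
open import Axiom.ExcludedMiddle using (ExcludedMiddle)
open import Data.List using (List; []; _∷_; [_]; _++_; map; filter; tabulate; applyUpTo)
open import Data.List.Membership.Propositional using (_∈_)
open import Data.List.Membership.Propositional.Properties
  using (∈-map⁺; ∈-map⁻; ∈-++⁺ˡ; ∈-++⁺ʳ; ∈-++⁻; ∈-filter⁺; ∈-filter⁻;
         ∈-concat⁺′; ∈-concat⁻′; ∈-tabulate⁺; ∈-applyUpTo⁺)
import Data.List.Relation.Binary.Subset.Propositional as List
open import Data.List.Relation.Unary.Any using (here; there)
open import Data.Product using (Σ; ∃; _×_; _,_; proj₁; proj₂)
open import Data.Sum using (_⊎_; inj₁; inj₂)
open import Function using (_∘_)
open import Relation.Binary using (Rel)
open import Relation.Binary.PropositionalEquality using (_≡_; refl)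
open import Relation.Nullary using (¬_; yes; no; contradiction)
open import Relation.Unary using (Pred; Decidable; _∩_; _⊆_; _≐_)
  renaming (_∉_ to _∉ₚ_)
open import Relation.Unary.Properties using (≐-refl; ≐-sym; ≐-trans)
open import Defs

private variable
  ℓ : Level
  E : Set ℓ

-- Enumerating subsets of a finite set

sublists : List E → List (List E)
sublists []       = [ [] ]
sublists (x ∷ xs) = map (x ∷_) (sublists xs) ++ sublists xs

[]∈sublists : (xs : List E) → [] ∈ sublists xs
[]∈sublists []       = here refl
[]∈sublists (x ∷ xs) = ∈-++⁺ʳ _ ([]∈sublists xs)

[x]∈sublists : ∀ {x : E} {xs} → x ∈ xs → [ x ] ∈ sublists xs
[x]∈sublists {xs = x ∷ xs} (here refl) = ∈-++⁺ˡ (∈-map⁺ (x ∷_) ([]∈sublists xs))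
[x]∈sublists {xs = x ∷ xs} (there x∈)  = ∈-++⁺ʳ _ ([x]∈sublists x∈)

-- Makes the trace of any decidable set on `xs` one of the enumerated candidates.
filter∈sublists : {P : Pred E ℓ} (P? : Decidable P) (xs : List E) →
  filter P? xs ∈ sublists xs
filter∈sublists P? []       = here refl
filter∈sublists P? (x ∷ xs) with P? x
... | yes _ = ∈-++⁺ˡ (∈-map⁺ (x ∷_) (filter∈sublists P? xs))
... | no  _ = ∈-++⁺ʳ _ (filter∈sublists P? xs)

∈sublists⇒⊆ : ∀ (xs : List E) {ys} → ys ∈ sublists xs → ys List.⊆ xs
∈sublists⇒⊆ []       (here refl) ()
∈sublists⇒⊆ (x ∷ xs) ys∈ y∈ with ∈-++⁻ (map (x ∷_) (sublists xs)) ys∈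
... | inj₂ ys∈′ = there (∈sublists⇒⊆ xs ys∈′ y∈)
... | inj₁ ys∈′ with ∈-map⁻ (x ∷_) ys∈′ | y∈
...   | zs , zs∈ , refl | here y≡x  = here y≡x
...   | zs , zs∈ , refl | there y∈′ = there (∈sublists⇒⊆ xs zs∈ y∈′)

∈-Cxt⁺ : ∀ {Z : Entries E} {X Y x} → (X , Y) ∈ Z → x ∈ X → x ∈ Cxt Z
∈-Cxt⁺ XY∈Z x∈X = ∈-concat⁺′ x∈X (∈-map⁺ proj₁ XY∈Z)

∈-Cxt⁻ : ∀ (Z : Entries E) {x} → x ∈ Cxt Z →
  ∃ λ X → ∃ λ Y → (X , Y) ∈ Z × x ∈ X
∈-Cxt⁻ Z x∈ with ∈-concat⁻′ (map proj₁ Z) x∈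
... | X , x∈X , X∈ with ∈-map⁻ proj₁ X∈
...   | (.X , Y) , XY∈Z , refl = X , Y , XY∈Z , x∈X

≈ᶻ-refl : (Z : Entries E) → Z ≈ᶻ Z
≈ᶻ-refl Z = ⊑-refl , ⊑-refl
  where
  ⊑-refl : Z ⊑ᶻ Z
  ⊑-refl XY∈Z = _ , _ , XY∈Z , ((λ z → z) , λ z → z) , ((λ z → z) , λ z → z)

module _ {E : Set ℓ} {_#_ : Rel E ℓ} where

  conflictFree-⊆ : {C D : Pred E ℓ} → C ⊆ D → ConflictFree _#_ D → ConflictFree _#_ C
  conflictFree-⊆ C⊆D cf x∈C y∈C = cf (C⊆D x∈C) (C⊆D y∈C)

  conflictFree-[] : ConflictFree _#_ ⟦ [] ⟧
  conflictFree-[] ()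

  conflictFree-[x] : ∀ {x} → ConflictFree _#_ ⟦ [ x ] ⟧
  conflictFree-[x] (here refl) (here refl) x≢x = contradiction refl x≢x

Before-finite : ∀ l (s : Position l → E) i → Σ (FinSet E) λ W → Before l s i ⊆ ⟦ W ⟧
-- An upper bound suffices: the whole sequence if it is finite, otherwise its first `i` terms.
Before-finite (finite n) s i = tabulate s , λ { (j , _ , refl) → ∈-tabulate⁺ j }
Before-finite ω          s i = applyUpTo s i , λ { (j , j<i , refl) → ∈-applyUpTo⁺ s j<i }

-- The same sequence serves both structures. Each set of earlier events is finite and inherits
-- conflict-freeness from the configuration, so enabledness has to be compared at such sets only.
Enabled-mono⇒Conf-⊆ : (𝐄 𝐄′ : CDES E) →
  (∀ {C} → ConflictFree (CDES._#_ 𝐄) C → ConflictFree (CDES._#_ 𝐄′) C) →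
  (∀ {D W e} → ConflictFree (CDES._#_ 𝐄) D → D ⊆ ⟦ W ⟧ → Enabled 𝐄 D e → Enabled 𝐄′ D e) →
  Conf 𝐄 ⊆ Conf 𝐄′
Enabled-mono⇒Conf-⊆ 𝐄 𝐄′ mono# monoEn c = record
  { len = len ; seq = seq ; distinct = distinct ; elements = elements
  ; conflictFree = λ {x} {y} → mono# conflictFree {x} {y}
  ; enabled = λ i → monoEn
      (conflictFree-⊆ {_#_ = CDES._#_ 𝐄}
        (λ { (j , _ , sj≡x) → proj₁ elements (j , sj≡x) }) conflictFree)
      (proj₂ (Before-finite len seq i)) (enabled i)
  }
  where open IsConfiguration c

-- Enabledness as selection of entries plus required events

module _ {E : Set ℓ} (𝐄 : CDES E) where
  open CDES 𝐄

  Selects : Pred E ℓ → Entries E → FinSet E → FinSet E → Set ℓ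
  Selects D Z X Y = (X , Y) ∈ Z × ⟦ Cxt Z ⟧ ∩ D ≐ ⟦ X ⟧

  Matched : E → Pred E ℓ → Set ℓ
  Matched e D = ∀ {Z} → Z ≫ e → ∃ λ X → ∃ λ Y → Selects D Z X Y

  -- A predicate and not a list, because infinitely many `Z` may be related to `e`.
  Required : E → Pred E ℓ → Pred E ℓ
  Required e D y =
    ∃ λ Z → Z ≫ e × ∃ λ X → ∃ λ Y → Selects D Z X Y × y ∈ Y

  -- `Matched` and `Required` see a set only through its intersections with the contexts of `e`, so
  -- both respect this relation.
  SameTrace : E → Pred E ℓ → Pred E ℓ → Set ℓ
  SameTrace e D D′ = ∀ {Z} → Z ≫ e → ⟦ Cxt Z ⟧ ∩ D ≐ ⟦ Cxt Z ⟧ ∩ D′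

  SameTrace-sym : ∀ {e D D′} → SameTrace e D D′ → SameTrace e D′ D
  SameTrace-sym same Z≫e = ≐-sym (same Z≫e)

  ≐⇒SameTrace : ∀ {e D D′} → D ≐ D′ → SameTrace e D D′
  ≐⇒SameTrace (D⊆D′ , D′⊆D) _ =
    (λ (z∈ , z∈D) → z∈ , D⊆D′ z∈D) , (λ (z∈ , z∈D′) → z∈ , D′⊆D z∈D′)

  Matched-resp : ∀ {e D D′} → SameTrace e D D′ → Matched e D → Matched e D′
  Matched-resp same matched Z≫e with matched Z≫e
  ... | X , Y , XY∈Z , D≐X = X , Y , XY∈Z , ≐-trans (≐-sym (same Z≫e)) D≐X

  Required-resp : ∀ {e D D′} → SameTrace e D D′ → Required e D ⊆ Required e D′
  Required-resp same (Z , Z≫e , X , Y , (XY∈Z , D≐X) , y∈Y) =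
    Z , Z≫e , X , Y , (XY∈Z , ≐-trans (≐-sym (same Z≫e)) D≐X) , y∈Y

  enabled⇒matched : ∀ {e D} → Enabled 𝐄 D e → Matched e D
  enabled⇒matched (_ , en) Z≫e with en Z≫e
  ... | X , Y , XY∈Z , D≐X , _ = X , Y , XY∈Z , D≐X

  -- Two entries of one `Z` selected at `D` have equal first components as sets, so `≫-functional`
  -- identifies their second components.
  enabled⇒required⊆ : ∀ {e D} → Enabled 𝐄 D e → Required e D ⊆ D
  enabled⇒required⊆ (_ , en) (Z , Z≫e , X , Y , (XY∈Z , D≐X) , y∈Y) with en Z≫e
  ... | X′ , Y′ , X′Y′∈Z , D≐X′ , Y′⊆D =
    Y′⊆D (proj₁ (≫-functional Z≫e XY∈Z X′Y′∈Z (≐-trans (≐-sym D≐X) D≐X′)) y∈Y)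

  matched⇒enabled : ∀ {e D} → e ∉ₚ D → Matched e D → Required e D ⊆ D → Enabled 𝐄 D e
  matched⇒enabled e∉D matched required⊆D = e∉D , λ Z≫e →
    let X , Y , XY∈Z , D≐X = matched Z≫e
    in  X , Y , XY∈Z , D≐X , λ y∈Y → required⊆D (_ , Z≫e , X , Y , (XY∈Z , D≐X) , y∈Y)

  -- Since `Y` is a list, the existence of such a `Y` also asserts that the required events are
  -- finite in number.
  Enabling : E → FinSet E → FinSet E → Set ℓ
  Enabling e X Y = Matched e ⟦ X ⟧ × Required e ⟦ X ⟧ ≐ ⟦ Y ⟧ × ConflictFree _#_ ⟦ Y ⟧

  Enabling-resp : ∀ {e X X′ Y} → X ≋ X′ → Enabling e X Y → Enabling e X′ Y
  Enabling-resp {e} {X} {X′} X≋X′ (matched , (R⊆Y , Y⊆R) , cf) =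
    Matched-resp same matched ,
    (R⊆Y ∘ Required-resp (SameTrace-sym same) , Required-resp same ∘ Y⊆R) , cf
    where
    same : SameTrace e ⟦ X ⟧ ⟦ X′ ⟧
    same = ≐⇒SameTrace X≋X′

-- The merged elementary structure

module Merge (em : ExcludedMiddle ℓ) {E : Set ℓ} (𝐄 : CDES E) (fin : FinitaryContexts 𝐄) where
  open CDES 𝐄

  em? : (P : Pred E ℓ) → Decidable P
  em? P x = em {P x}

  conflictFree? : Decidable (λ X → ConflictFree _#_ ⟦ X ⟧)
  conflictFree? X = em

  bound : E → FinSet E
  bound e = proj₁ (fin e)

  requirement : E → FinSet E → FinSet E
  requirement e X with em {∃ (Enabling 𝐄 e X)}
  ... | yes (Y , _) = Y
  ... | no  _       = [ e ]

  requirement-spec : ∀ e X → Enabling 𝐄 e X (requirement e X) ⊎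
    (¬ ∃ (Enabling 𝐄 e X)) × requirement e X ≡ [ e ]
  requirement-spec e X with em {∃ (Enabling 𝐄 e X)}
  ... | yes (_ , enabling) = inj₁ enabling
  ... | no  ¬enabling      = inj₂ (¬enabling , refl)

  requirement-conflictFree : ∀ e X → ConflictFree _#_ ⟦ requirement e X ⟧
  requirement-conflictFree e X with em {∃ (Enabling 𝐄 e X)}
  ... | yes (_ , _ , _ , cf) = cf
  ... | no  _                = conflictFree-[x] {_#_ = _#_}

  requirement-cong : ∀ e {X X′} → X ≋ X′ → requirement e X ≋ requirement e X′
  requirement-cong e {X} {X′} X≋X′
    with em {∃ (Enabling 𝐄 e X)} | em {∃ (Enabling 𝐄 e X′)}
  -- The two calls of `em` may return different lists, but both enumerate the same set of required
  -- events.
  ... | yes (_ , enabling) | yes (_ , _ , R≐Y′ , _) =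
    ≐-trans (≐-sym (proj₁ (proj₂ (Enabling-resp 𝐄 X≋X′ enabling)))) R≐Y′
  ... | yes (Y , enabling) | no ¬enabling =
    contradiction (Y , Enabling-resp 𝐄 X≋X′ enabling) ¬enabling
  ... | no ¬enabling | yes (Y , enabling) =
    contradiction (Y , Enabling-resp 𝐄 (≐-sym X≋X′) enabling) ¬enabling
  ... | no _ | no _ = ≐-refl

  -- One set may occur here as several lists `X`; `requirement-cong` keeps the pairing functional up
  -- to `≋`.
  entries : E → Entries E
  entries e = map (λ X → X , requirement e X) (filter conflictFree? (sublists (bound e)))

  ∈-entries⁺ : ∀ {e X} → X ∈ sublists (bound e) → ConflictFree _#_ ⟦ X ⟧ →
    (X , requirement e X) ∈ entries e
  ∈-entries⁺ X∈ cf = ∈-map⁺ _ (∈-filter⁺ conflictFree? X∈ cf)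

  ∈-entries⁻ : ∀ {e X Y} → (X , Y) ∈ entries e →
    X ∈ sublists (bound e) × ConflictFree _#_ ⟦ X ⟧ × Y ≡ requirement e X
  ∈-entries⁻ {e} XY∈ with ∈-map⁻ _ XY∈
  ... | X , X∈ , refl with ∈-filter⁻ conflictFree? {xs = sublists (bound e)} X∈
  ...   | X∈′ , cf = X∈′ , cf , refl

  Cxt-entries : ∀ e → Cxt (entries e) ≋ bound e
  Cxt-entries e = Cxt⊆ , λ u∈ →
    ∈-Cxt⁺ (∈-entries⁺ ([x]∈sublists u∈) (conflictFree-[x] {_#_ = _#_})) (here refl)
    where
    Cxt⊆ : Cxt (entries e) List.⊆ bound e
    Cxt⊆ x∈ with ∈-Cxt⁻ (entries e) x∈
    ... | X , Y , XY∈ , x∈X = ∈sublists⇒⊆ (bound e) (proj₁ (∈-entries⁻ {e} XY∈)) x∈X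

  merged : CDES E
  merged = record
    { _#_ = _#_
    ; _≫_ = λ Z e → Z ≡ entries e
    ; #-irrefl = #-irrefl
    ; #-sym = #-sym
    ; ≫-nonempty = λ {_} {e} → nonempty e
    ; ≫-conflictFree = λ {_} {e} → free e
    ; ≫-functional = λ {_} {e} → functional e
    }
    where
    nonempty : ∀ e {Z} → Z ≡ entries e → ¬ (Z ≡ [])
    nonempty e refl Z≡[]
      -- The empty set always contributes an entry.
      with entries e | ∈-entries⁺ {e} ([]∈sublists (bound e)) (conflictFree-[] {_#_ = _#_})
    nonempty e refl refl | .[] | ()

    free : ∀ e {Z X Y} → Z ≡ entries e → (X , Y) ∈ Z →
      ConflictFree _#_ ⟦ X ⟧ × ConflictFree _#_ ⟦ Y ⟧
    free e {X = X} refl XY∈ with ∈-entries⁻ {e} XY∈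
    ... | _ , cf , refl = cf , requirement-conflictFree e X

    functional : ∀ e {Z X Y X′ Y′} → Z ≡ entries e → (X , Y) ∈ Z → (X′ , Y′) ∈ Z →
      X ≋ X′ → Y ≋ Y′
    functional e refl XY∈ X′Y′∈ X≋X′ with ∈-entries⁻ {e} XY∈ | ∈-entries⁻ {e} X′Y′∈
    ... | _ , _ , refl | _ , _ , refl = requirement-cong e X≋X′

  merged-elementary : Elementary merged
  merged-elementary e = entries e , refl , λ { refl → ≈ᶻ-refl (entries e) }

  -- Comparing enabledness in the two structures

  trace-on-bound : ∀ {e D X} → ⟦ bound e ⟧ ∩ D ≐ ⟦ X ⟧ → SameTrace 𝐄 e D ⟦ X ⟧
  trace-on-bound {e} (⊆X , X⊆) Z≫e =
    (λ (z∈ , z∈D) → z∈ , ⊆X (proj₂ (fin e) Z≫e z∈ , z∈D)) ,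
    (λ (z∈ , z∈X) → z∈ , proj₂ (X⊆ z∈X))

  Cxt-entries-trace : ∀ e (D : Pred E ℓ) → ⟦ Cxt (entries e) ⟧ ∩ D ≐ ⟦ bound e ⟧ ∩ D
  Cxt-entries-trace e D =
    (λ (z∈ , z∈D) → proj₁ (Cxt-entries e) z∈ , z∈D) ,
    (λ (z∈ , z∈D) → proj₂ (Cxt-entries e) z∈ , z∈D)

  -- Finiteness of D, by W, makes the union of the selected Y's finite.
  enabled⇒merged-enabled : ∀ {D W e} → ConflictFree _#_ D → D ⊆ ⟦ W ⟧ →
    Enabled 𝐄 D e → Enabled merged D e
  enabled⇒merged-enabled {D} {W} {e} cf D⊆W en = proj₁ en , λ { refl →
    X , requirement e X ,
    ∈-entries⁺ (filter∈sublists (em? D) (bound e))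
      (conflictFree-⊆ {_#_ = _#_} {D = D} (proj₂ ∘ proj₂ U∩D≐X) cf) ,
    ≐-trans (Cxt-entries-trace e D) U∩D≐X ,
    requirement⊆D }
    where
    X Y : FinSet E
    -- `X` lists the trace of `D` on the bound. The required events lie in `D`, hence in `W`, so
    -- sifting `W` lists them all.
    X = filter (em? D) (bound e)
    Y = filter (em? (Required 𝐄 e ⟦ X ⟧)) W

    U∩D≐X : ⟦ bound e ⟧ ∩ D ≐ ⟦ X ⟧
    U∩D≐X = (λ (x∈ , x∈D) → ∈-filter⁺ (em? D) x∈ x∈D) , ∈-filter⁻ (em? D) {xs = bound e}

    same : SameTrace 𝐄 e D ⟦ X ⟧
    same = trace-on-bound U∩D≐X

    required⊆D : Required 𝐄 e ⟦ X ⟧ ⊆ D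
    required⊆D = enabled⇒required⊆ 𝐄 en ∘ Required-resp 𝐄 (SameTrace-sym 𝐄 same)

    Y⊆required : ⟦ Y ⟧ ⊆ Required 𝐄 e ⟦ X ⟧
    Y⊆required = proj₂ ∘ ∈-filter⁻ (em? (Required 𝐄 e ⟦ X ⟧)) {xs = W}

    enabling : Enabling 𝐄 e X Y
    enabling =
      Matched-resp 𝐄 same (enabled⇒matched 𝐄 en) ,
      ((λ r → ∈-filter⁺ (em? (Required 𝐄 e ⟦ X ⟧)) (D⊆W (required⊆D r)) r) , Y⊆required) ,
      conflictFree-⊆ {_#_ = _#_} {D = D} (required⊆D ∘ Y⊆required) cf

    requirement⊆D : ⟦ requirement e X ⟧ ⊆ D
    -- The list chosen by `requirement` may differ from `Y`; the existence of `Y` rules out the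
    -- default `[ e ]`.
    requirement⊆D with requirement-spec e X
    ... | inj₁ (_ , (_ , ⊆R) , _) = required⊆D ∘ ⊆R
    ... | inj₂ (¬enabling , _)    = contradiction (Y , enabling) ¬enabling

  -- As `e` is outside `D`, the selected entry cannot carry the default `[ e ]`. It is therefore
  -- enabling, and its properties pass from `X` to `D` because both have the same trace on every
  -- context of `e`.
  merged-enabled⇒enabled : ∀ {D e} → Enabled merged D e → Enabled 𝐄 D e
  merged-enabled⇒enabled {D} {e} (e∉D , en) with en refl
  ... | X , Y , XY∈ , trace , Y⊆D with ∈-entries⁻ {e} XY∈
  ...   | _ , _ , refl with requirement-spec e X
  ...     | inj₂ (_ , req≡[e]) rewrite req≡[e] = contradiction (Y⊆D (here refl)) e∉D
  ...     | inj₁ (matched , (R⊆Y , _) , _) =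
    matched⇒enabled 𝐄 e∉D (Matched-resp 𝐄 (SameTrace-sym 𝐄 same) matched)
      (Y⊆D ∘ R⊆Y ∘ Required-resp 𝐄 same)
    where
    same : SameTrace 𝐄 e D ⟦ X ⟧
    same = trace-on-bound (≐-trans (≐-sym (Cxt-entries-trace e D)) trace)

mainTheorem4 : ∀ {ℓ : Level} → ExcludedMiddle ℓ →
    {E : Set ℓ} (𝐄 : CDES E) → FinitaryContexts 𝐄 →
    Σ (CDES E) λ 𝐄′ → Elementary 𝐄′ × (Conf 𝐄 ≐ Conf 𝐄′)
mainTheorem4 em 𝐄 fin =
  merged , merged-elementary ,
  Enabled-mono⇒Conf-⊆ 𝐄 merged (λ cf → cf) enabled⇒merged-enabled ,
  Enabled-mono⇒Conf-⊆ merged 𝐄 (λ cf → cf) (λ _ _ → merged-enabled⇒enabled)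
  where open Merge em 𝐄 fin
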